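{- Let $x\in(0,1)$ be an irrational number and let $n$ be a positive integer. If $k=k(x,n)$ is the only positive integer such that $$q_k(x)+q_{k-1}(x)\le n+1<q_{k+1}(x)+q_k(x),$$ then $$L_n(x,\mathcal F,\mathcal{CF})=k.$$
   Context: $\mathbb N$ includes $0$. For an irrational $x\in(0,1)$ with continued fraction expansion $x=[0;a_1,a_2,\dots]$, set $p_{ -1}=1,p_0=0,q_{ -1}=0,q_0=1$, $p_n=a_np_{n-1}+p_{n-2}$, $q_n=q_n(x)=a_nq_{n-1}+q_{n-2}$. $\mathcal{CF}$ is the continued fraction sequence of partitions of $[0,1]$ into open intervals: its depth-$0$ partition is $\{(0,1)\}$, and its depth-$n$ interval containing the irrational $x$ ($n\ge1$) is the open interval $I_n^{\mathcal{CF}}(x)$ with endpoints $\frac{p_n}{q_n}$ and $\frac{p_n+p_{n-1}}{q_n+q_{n-1}}$. $\mathcal F=\{F_n\}_{n\in\mathbb N}$ is the Farey sequence of partitions: $F_n$ consists of the open intervals between consecutive elements of $\{p/q:0\le p\le q\le n+1,\ q\ge1,\ \gcd(p,q)=1\}$, and $I_n^{\mathcal F}(x)$ is the interval of $F_n$ containing $x$. The Lochs index is $L_n(x,\mathcal F,\mathcal{CF})=\sup\{\ell\in\mathbb N: I_n^{\mathcal F}(x)\subseteq I_\ell^{\mathcal{CF}}(x)\}$. -}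

module Defs where

open import Data.Integer.Base using (+_)
open import Data.Nat.Base as ℕ using (ℕ; zero; suc; NonZero)
open import Data.Nat.GCD using (gcd)
open import Data.Nat.Properties using (m*n≢0)
open import Data.Product.Base using (∃; ∃-syntax; _×_; _,_)
open import Data.Rational.Base using (ℚ; 0ℚ; 1ℚ; _/_; _+_; _-_; -_; _<_; _⊓_; _⊔_)
open import Data.Rational.Properties
  using (<-cmp; <-trans; <-asym; <-dense; +-identityʳ; +-monoʳ-<; negative⁻¹; positive⁻¹)
open import Data.Sum.Base using (_⊎_; inj₁; inj₂)
open import Function.Bundles using (_⇔_)
open import Relation.Binary.Definitions using (tri<; tri≈; tri>)
open import Relation.Binary.PropositionalEquality using (_≡_; refl; subst)
open import Relation.Nullary using (¬_)

-- Two-sided Dedekind cuts: lower r means r < x, upper r means x < r.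
record ℝ : Set₁ where
  field
    lower upper     : ℚ → Set
    lower-inhabited : ∃ lower
    upper-inhabited : ∃ upper
    lower-closed    : ∀ {r s} → r < s → lower s → lower r
    upper-closed    : ∀ {r s} → r < s → upper r → upper s
    lower-open      : ∀ {r} → lower r → ∃[ s ] r < s × lower s
    upper-open      : ∀ {s} → upper s → ∃[ r ] r < s × upper r
    disjoint        : ∀ {r} → ¬ (lower r × upper r)
    located         : ∀ {r s} → r < s → lower r ⊎ upper s

open ℝ public

fromℚ : ℚ → ℝ
fromℚ q = record
  { lower           = _< q
  ; upper           = q <_
  ; lower-inhabited = q - 1ℚ , subst (q - 1ℚ <_) (+-identityʳ q) (+-monoʳ-< q (negative⁻¹ (- 1ℚ)))
  ; upper-inhabited = q + 1ℚ , subst (_< q + 1ℚ) (+-identityʳ q) (+-monoʳ-< q (positive⁻¹ 1ℚ))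
  ; lower-closed    = <-trans
  ; upper-closed    = λ r<s q<r → <-trans q<r r<s
  ; lower-open      = <-dense
  ; upper-open      = λ q<s → let m , q<m , m<s = <-dense q<s in m , m<s , q<m
  ; disjoint        = λ (r<q , q<r) → <-asym r<q q<r
  ; located         = loc
  }
  where
  loc : ∀ {r s} → r < s → r < q ⊎ q < s
  loc {r} r<s with <-cmp r q
  ... | tri< r<q _ _  = inj₁ r<q
  ... | tri≈ _ refl _ = inj₂ r<s
  ... | tri> _ _ q<r  = inj₂ (<-trans q<r r<s)

infix 4 _≃_

_≃_ : ℝ → ℝ → Set
x ≃ y = (∀ r → lower x r ⇔ lower y r) × (∀ r → upper x r ⇔ upper y r)

Irrational : ℝ → Set
Irrational x = ∀ r → ¬ (x ≃ fromℚ r)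

-- For every ε > 0, eventually s m - ε < x < s m + ε.
_⟶_ : (ℕ → ℚ) → ℝ → Set
s ⟶ x = ∀ ε → 0ℚ < ε → ∃[ N ] ∀ m → N ℕ.≤ m →
  lower x (s m - ε) × upper x (s m + ε)

-- An open interval with rational endpoints.
record Interval : Set where
  constructor ⟨_,_⟩
  field
    left right : ℚ

open Interval public

infix 4 _∈_ _⊆_

_∈_ : ℝ → Interval → Set
x ∈ I = lower x (left I) × upper x (right I)

_⊆_ : Interval → Interval → Set₁
I ⊆ J = ∀ y → y ∈ I → y ∈ J

unitInterval : Interval
unitInterval = ⟨ 0ℚ , 1ℚ ⟩

-- The open interval with endpoints u and v, given in either order.
between : ℚ → ℚ → Interval
between u v = ⟨ u ⊓ v , u ⊔ v ⟩

-- digit n is aₙ for n ≥ 1; the value digit 0 is never used.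
record PartialQuotients : Set where
  field
    digit   : ℕ → ℕ
    nonZero : ∀ n → NonZero (digit (suc n))

open PartialQuotients public

-- p a n = pₙ and p₋₁ a n = pₙ₋₁ (so p₋₁ a 0 is the initial value p₋₁ = 1);
-- likewise for q and q₋₁.
module _ (a : PartialQuotients) where

  p p₋₁ q q₋₁ : ℕ → ℕ

  p zero    = 0
  p (suc n) = digit a (suc n) ℕ.* p n ℕ.+ p₋₁ n

  p₋₁ zero    = 1
  p₋₁ (suc n) = p n

  q zero    = 1
  q (suc n) = digit a (suc n) ℕ.* q n ℕ.+ q₋₁ n

  q₋₁ zero    = 0
  q₋₁ (suc n) = q n

private
  +-nonZeroˡ : ∀ m n → .{{NonZero m}} → NonZero (m ℕ.+ n)
  +-nonZeroˡ (suc _) _ = _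

q-nonZero : ∀ {a n} → NonZero (q a n)
q-nonZero {a} {zero}  = _
q-nonZero {a} {suc n} =
  +-nonZeroˡ (digit a (suc n) ℕ.* q a n) (q₋₁ a n)
    {{m*n≢0 (digit a (suc n)) (q a n) {{nonZero a n}} {{q-nonZero {a} {n}}}}}

q+q₋₁-nonZero : ∀ {a n} → NonZero (q a n ℕ.+ q₋₁ a n)
q+q₋₁-nonZero {a} {n} = +-nonZeroˡ (q a n) (q₋₁ a n) {{q-nonZero {a} {n}}}

convergent : PartialQuotients → ℕ → ℚ
convergent a n = _/_ (+ p a n) (q a n) {{q-nonZero {a} {n}}}

-- (pₙ + pₙ₋₁) / (qₙ + qₙ₋₁)
mediant : PartialQuotients → ℕ → ℚ
mediant a n =
  _/_ (+ (p a n ℕ.+ p₋₁ a n)) (q a n ℕ.+ q₋₁ a n) {{q+q₋₁-nonZero {a} {n}}}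

-- x = [0; a₁, a₂, …].
_≃[0⨾_] : ℝ → PartialQuotients → Set
x ≃[0⨾ a ] = convergent a ⟶ x

-- The depth-n interval of 𝒞ℱ containing x = [0; a₁, a₂, …].
cfInterval : PartialQuotients → ℕ → Interval
cfInterval a zero      = unitInterval
cfInterval a n@(suc _) = between (convergent a n) (mediant a n)

-- The elements of {p/q : 0 ≤ p ≤ q ≤ n+1, q ≥ 1, gcd(p,q) = 1}.
record FareyPoint (n : ℕ) (r : ℚ) : Set where
  field
    num den     : ℕ
    {{den≢0}}   : NonZero den
    num≤den     : num ℕ.≤ den
    den≤n+1     : den ℕ.≤ n ℕ.+ 1
    coprime     : gcd num den ≡ 1
    r≡num/den   : r ≡ + num / den

-- Membership in the partition Fₙ.
record FareyInterval (n : ℕ) (I : Interval) : Set where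
  field
    left-point  : FareyPoint n (left I)
    right-point : FareyPoint n (right I)
    left<right  : left I < right I
    consecutive : ∀ s → FareyPoint n s → ¬ (left I < s × s < right I)

IsSupremum : ∀ {ℓ} → (ℕ → Set ℓ) → ℕ → Set ℓ
IsSupremum S k = (∀ ℓ → S ℓ → ℓ ℕ.≤ k) × (∀ m → (∀ ℓ → S ℓ → ℓ ℕ.≤ m) → k ℕ.≤ m)

-- Lₙ(x, ℱ, 𝒞ℱ) = k, for x = [0; a₁, a₂, …].  The interval I of Fₙ containing x
-- is unique because distinct members of Fₙ are disjoint.
LochsIndex : ℝ → PartialQuotients → ℕ → ℕ → Set₁
LochsIndex x a n k =
  ∃[ I ] FareyInterval n I × x ∈ I × IsSupremum (λ ℓ → I ⊆ cfInterval a ℓ) k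

-- qₖ + qₖ₋₁ ≤ n + 1 < qₖ₊₁ + qₖ
Window : PartialQuotients → ℕ → ℕ → Set
Window a n k =
  q a k ℕ.+ q₋₁ a k ℕ.≤ n ℕ.+ 1 × n ℕ.+ 1 ℕ.< q a (suc k) ℕ.+ q a k

{-# OPTIONS --safe #-}
module Submission where

-- The interval of Fₙ containing x has endpoints pₖ/qₖ and the semiconvergent
-- (j pₖ + pₖ₋₁) / (j qₖ + qₖ₋₁), with j ≥ 1 the largest for which the denominator is
-- at most n + 1: these fractions have determinant ±1, so a fraction strictly between
-- them has denominator at least (j + 1) qₖ + qₖ₋₁ > n + 1.  Semiconvergents move
-- monotonically from the mediant (j = 1) to the next convergent (j = aₖ₊₁), so this
-- interval contains x and lies in the depth-k interval.  It lies in no deeper one,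
-- because its endpoint pₖ/qₖ is not in the closure of any of those.

open import Defs
open import Algebra.Properties.AbelianGroup using (⁻¹-anti-homo‿-; xyx⁻¹≈y)
open import Data.Empty using (⊥-elim)
open import Data.Integer.Base as ℤ using (+_; +<+; +≤+)
open import Data.Integer.Properties using (pos-*; drop‿+<+)
open import Data.Nat.Base using (ℕ; zero; suc; NonZero; _+_; _*_; _∸_; _≤_; _<_; z≤n; s≤s;
  >-nonZero; >-nonZero⁻¹)
import Data.Nat.Base as ℕ
open import Data.Nat.Divisibility using (_∣_; ∣m⇒∣m*n; ∣m+n∣m⇒∣n; ∣1⇒≡1)
open import Data.Nat.GCD using (gcd; gcd-comm; gcd[m,n]∣m; gcd[m,n]∣n)
open import Data.Nat.Properties
open import Data.Nat.Tactic.RingSolver using (solve-∀)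
open import Data.Product.Base using (∃-syntax; _×_; _,_; proj₁; proj₂)
open import Data.Rational.Base as ℚ using (ℚ; 0ℚ; _/_; _⊓_; _⊔_)
import Data.Rational.Properties as ℚₚ
open import Data.Rational.Unnormalised.Base using (mkℚᵘ; *<*; *≤*)
import Data.Rational.Unnormalised.Properties as ℚᵘₚ
open import Data.Sum.Base using (_⊎_; inj₁; inj₂)
open import Relation.Binary.PropositionalEquality
  using (_≡_; refl; sym; trans; cong; subst; subst₂; module ≡-Reasoning)
open import Relation.Nullary using (¬_; yes; no)

-- Order of fractions by cross-multiplication.

-- `_/_` reduces to lowest terms and so hides the given numerator and denominator. Unnormalised
-- rationals keep them, and there the order is cross-multiplication by definition.
/-mono-< : ∀ a b c d .{{_ : NonZero b}} .{{_ : NonZero d}} → a * d < c * b → + a / b ℚ.< + c / d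
/-mono-< a b@(suc b-1) c d@(suc d-1) ad<cb = ℚₚ.toℚᵘ-cancel-<
  (ℚᵘₚ.<-respˡ-≃ (ℚᵘₚ.≃-sym (ℚₚ.toℚᵘ-fromℚᵘ (mkℚᵘ (+ a) b-1)))
  (ℚᵘₚ.<-respʳ-≃ (ℚᵘₚ.≃-sym (ℚₚ.toℚᵘ-fromℚᵘ (mkℚᵘ (+ c) d-1)))
  (*<* (subst₂ ℤ._<_ (pos-* a d) (pos-* c b) (+<+ ad<cb)))))

/-mono-≤ : ∀ a b c d .{{_ : NonZero b}} .{{_ : NonZero d}} → a * d ≤ c * b → + a / b ℚ.≤ + c / d
/-mono-≤ a b@(suc b-1) c d@(suc d-1) ad≤cb = ℚₚ.toℚᵘ-cancel-≤
  (ℚᵘₚ.≤-respˡ-≃ (ℚᵘₚ.≃-sym (ℚₚ.toℚᵘ-fromℚᵘ (mkℚᵘ (+ a) b-1)))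
  (ℚᵘₚ.≤-respʳ-≃ (ℚᵘₚ.≃-sym (ℚₚ.toℚᵘ-fromℚᵘ (mkℚᵘ (+ c) d-1)))
  (*≤* (subst₂ ℤ._≤_ (pos-* a d) (pos-* c b) (+≤+ ad≤cb)))))

/-cancel-< : ∀ a b c d .{{_ : NonZero b}} .{{_ : NonZero d}} → + a / b ℚ.< + c / d → a * d < c * b
/-cancel-< a b@(suc b-1) c d@(suc d-1) lt
  with ℚᵘₚ.<-respˡ-≃ (ℚₚ.toℚᵘ-fromℚᵘ (mkℚᵘ (+ a) b-1))
         (ℚᵘₚ.<-respʳ-≃ (ℚₚ.toℚᵘ-fromℚᵘ (mkℚᵘ (+ c) d-1)) (ℚₚ.toℚᵘ-mono-< lt))
... | *<* ad<cb = drop‿+<+ (subst₂ ℤ._<_ (sym (pos-* a d)) (sym (pos-* c b)) ad<cb)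

-- Fractions of determinant 1 and Farey neighbours.

det≡1⇒gcd≡1 : ∀ m n u v → m * u ≡ n * v + 1 → gcd m n ≡ 1
det≡1⇒gcd≡1 m n u v eq = ∣1⇒≡1 (∣m+n∣m⇒∣n
  (subst (gcd m n ∣_) eq (∣m⇒∣m*n u (gcd[m,n]∣m m n)))
  (∣m⇒∣m*n v (gcd[m,n]∣n m n)))

-- Since `c b - a d = 1`, one has `f = d (e b - a f) + b (c f - e d)`, and both brackets are at
-- least 1. Adding `a f d` to both sides avoids subtraction.
den-between-adjacent : ∀ a b c d e f → c * b ≡ a * d + 1 →
                       a * f < e * b → e * d < c * f → b + d ≤ f
den-between-adjacent a b c d e f det af<eb ed<cf = +-cancelˡ-≤ (a * f * d) (b + d) f (begin
  a * f * d + (b + d)    ≡⟨ lhs a b d f ⟩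
  suc (a * f) * d + b    ≤⟨ +-monoˡ-≤ b (*-monoˡ-≤ d af<eb) ⟩
  e * b * d + b          ≡⟨ mid b d e ⟩
  suc (e * d) * b        ≤⟨ *-monoˡ-≤ b ed<cf ⟩
  c * f * b              ≡⟨ swapʳ c f b ⟩
  c * b * f              ≡⟨ cong (_* f) det ⟩
  (a * d + 1) * f        ≡⟨ rhs a d f ⟩
  a * f * d + f          ∎)
  where
  open ≤-Reasoning
  lhs : ∀ a b d f → a * f * d + (b + d) ≡ suc (a * f) * d + b
  lhs = solve-∀
  mid : ∀ b d e → e * b * d + b ≡ suc (e * d) * b
  mid = solve-∀
  swapʳ : ∀ c f b → c * f * b ≡ c * b * f
  swapʳ = solve-∀
  rhs : ∀ a d f → (a * d + 1) * f ≡ a * f * d + f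
  rhs = solve-∀

m≡n+1⇒n<m : ∀ {m n} → m ≡ n + 1 → n < m
m≡n+1⇒n<m {n = n} refl = m<m+n n (s≤s z≤n)

adjacent⇒FareyInterval : ∀ n a b c d {{_ : NonZero b}} {{_ : NonZero d}} →
  a ≤ b → c ≤ d → b ≤ n + 1 → d ≤ n + 1 →
  c * b ≡ a * d + 1 → n + 1 < b + d →
  FareyInterval n ⟨ + a / b , + c / d ⟩
adjacent⇒FareyInterval n a b c d a≤b c≤d b≤n+1 d≤n+1 det n+1<b+d = record
  { left-point  = record
    { num = a ; den = b ; num≤den = a≤b ; den≤n+1 = b≤n+1
    ; coprime = trans (gcd-comm a b)
        (det≡1⇒gcd≡1 b a c d (trans (*-comm b c) det))
    ; r≡num/den = refl }
  ; right-point = record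
    { num = c ; den = d ; num≤den = c≤d ; den≤n+1 = d≤n+1
    ; coprime = det≡1⇒gcd≡1 c d b a (trans det (cong (_+ 1) (*-comm a d)))
    ; r≡num/den = refl }
  ; left<right  = /-mono-< a b c d (m≡n+1⇒n<m det)
  ; consecutive = gap
  }
  where
  gap : ∀ s → FareyPoint n s → ¬ (+ a / b ℚ.< s × s ℚ.< + c / d)
  gap _ record { num = e ; den = f ; den≤n+1 = f≤n+1 ; r≡num/den = refl } (l , r) =
    <⇒≱ n+1<b+d (≤-trans
      (den-between-adjacent a b c d e f det (/-cancel-< a b e f l) (/-cancel-< e f c d r))
      f≤n+1)

-- Cuts and inclusion of intervals.

-- `lower-closed` asks for a strict inequality; openness of the cut supplies the slack when `r` and
-- `s` coincide.
lower-≤ : ∀ x {r s} → r ℚ.≤ s → lower x s → lower x r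
lower-≤ x r≤s ls = let _ , s<t , lt = lower-open x ls in lower-closed x (ℚₚ.≤-<-trans r≤s s<t) lt

upper-≤ : ∀ x {r s} → r ℚ.≤ s → upper x r → upper x s
upper-≤ x r≤s ur = let _ , t<r , ut = upper-open x ur in upper-closed x (ℚₚ.<-≤-trans t<r r≤s) ut

⊆-intro : ∀ {I J} → left J ℚ.≤ left I → right I ℚ.≤ right J → I ⊆ J
⊆-intro l r y (ly , uy) = lower-≤ y l ly , upper-≤ y r uy

⊓-pres-< : ∀ {r s t} → r ℚ.< s → r ℚ.< t → r ℚ.< s ⊓ t
⊓-pres-< {r} {s} {t} r<s r<t with ℚₚ.⊓-sel s t
... | inj₁ eq = subst (r ℚ.<_) (sym eq) r<s
... | inj₂ eq = subst (r ℚ.<_) (sym eq) r<t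

left<left⇒⊈ : ∀ {I J} → left I ℚ.< right I → left I ℚ.< left J → ¬ (I ⊆ J)
left<left⇒⊈ {I} {J} ne lt I⊆J =
  -- A rational `t` in `I` but to the left of `J`, taken as a real, refutes the inclusion.
  let t , l<t , t<m = ℚₚ.<-dense (⊓-pres-< ne lt)
      t∈J = I⊆J (fromℚ t) (l<t , ℚₚ.<-≤-trans t<m (ℚₚ.p⊓q≤p (right I) (left J)))
  in ℚₚ.<-asym (proj₁ t∈J) (ℚₚ.<-≤-trans t<m (ℚₚ.p⊓q≤q (right I) (left J)))

⊔-pres-< : ∀ {r s t} → s ℚ.< r → t ℚ.< r → s ⊔ t ℚ.< r
⊔-pres-< {r} {s} {t} s<r t<r with ℚₚ.⊔-sel s t
... | inj₁ eq = subst (ℚ._< r) (sym eq) s<r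
... | inj₂ eq = subst (ℚ._< r) (sym eq) t<r

right<right⇒⊈ : ∀ {I J} → left I ℚ.< right I → right J ℚ.< right I → ¬ (I ⊆ J)
right<right⇒⊈ {I} {J} ne lt I⊆J =
  let t , m<t , t<r = ℚₚ.<-dense (⊔-pres-< ne lt)
      t∈J = I⊆J (fromℚ t) (ℚₚ.≤-<-trans (ℚₚ.p≤p⊔q (left I) (right J)) m<t , t<r)
  in ℚₚ.<-asym (proj₂ t∈J) (ℚₚ.≤-<-trans (ℚₚ.p≤q⊔p (left I) (right J)) m<t)

-- Bounds on limits.

private
  t+[r-t]≡r : ∀ t r → t ℚ.+ (r ℚ.- t) ≡ r
  t+[r-t]≡r t r = trans (sym (ℚₚ.+-assoc t r (ℚ.- t))) (xyx⁻¹≈y ℚₚ.+-0-abelianGroup t r)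

  t-[t-r]≡r : ∀ t r → t ℚ.- (t ℚ.- r) ≡ r
  t-[t-r]≡r t r = trans
    (cong (t ℚ.+_) (⁻¹-anti-homo‿- ℚₚ.+-0-abelianGroup t r)) (t+[r-t]≡r t r)

  0<t-r : ∀ {r t} → r ℚ.< t → 0ℚ ℚ.< t ℚ.- r
  0<t-r {r} {t} r<t = subst (ℚ._< t ℚ.- r) (ℚₚ.+-inverseʳ r) (ℚₚ.+-monoˡ-< (ℚ.- r) r<t)

-- With `ε = t - r`, any late enough term satisfies `s m - ε ≥ t - ε = r`, and `s m - ε` is in the
-- lower cut.
lower-limit : ∀ x {s r t} M → s ⟶ x → r ℚ.< t → (∀ m → M ≤ m → t ℚ.≤ s m) → lower x r
lower-limit x {s} {r} {t} M s⟶x r<t t≤s =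
  let N , close = s⟶x (t ℚ.- r) (0<t-r r<t)
      m = M ℕ.⊔ N
  in lower-≤ x
       (subst (ℚ._≤ s m ℚ.- (t ℚ.- r)) (t-[t-r]≡r t r)
         (ℚₚ.+-monoˡ-≤ (ℚ.- (t ℚ.- r)) (t≤s m (m≤m⊔n M N))))
       (proj₁ (close m (m≤n⊔m M N)))

upper-limit : ∀ x {s r t} M → s ⟶ x → t ℚ.< r → (∀ m → M ≤ m → s m ℚ.≤ t) → upper x r
upper-limit x {s} {r} {t} M s⟶x t<r s≤t =
  let N , close = s⟶x (r ℚ.- t) (0<t-r t<r)
      m = M ℕ.⊔ N
  in upper-≤ x
       (subst (s m ℚ.+ (r ℚ.- t) ℚ.≤_) (t+[r-t]≡r t r)
         (ℚₚ.+-monoˡ-≤ (r ℚ.- t) (s≤t m (m≤m⊔n M N))))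
       (proj₂ (close m (m≤n⊔m M N)))

-- Arithmetic of semiconvergents.

-- Adding a multiple of one column to the other keeps a determinant. Used with the next digit for
-- convergents and with smaller multipliers for semiconvergents.
adjacent-step : ∀ i u u′ v v′ → u′ * v ≡ u * v′ + 1 → (i * u + u′) * v ≡ u * (i * v + v′) + 1
adjacent-step i u u′ v v′ eq = begin
  (i * u + u′) * v              ≡⟨ *-distribʳ-+ v (i * u) u′ ⟩
  i * u * v + u′ * v            ≡⟨ cong (λ e → i * u * v + e) eq ⟩
  i * u * v + (u * v′ + 1)      ≡⟨ regroup i u v v′ ⟩
  u * (i * v + v′) + 1          ∎
  where
  open ≡-Reasoning
  regroup : ∀ i u v v′ → i * u * v + (u * v′ + 1) ≡ u * (i * v + v′) + 1
  regroup = solve-∀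

-- (i u + u′) / (i v + v′) moves from u′ / v′ towards u / v as i grows.
semiconvergent-antitone : ∀ {i j} u u′ v v′ → u * v′ ≤ u′ * v → i ≤ j →
                          (j * u + u′) * (i * v + v′) ≤ (i * u + u′) * (j * v + v′)
semiconvergent-antitone {i} u u′ v v′ uv′≤u′v i≤j with m≤n⇒∃[o]m+o≡n i≤j
... | o , refl = begin
  ((i + o) * u + u′) * (i * v + v′)                ≡⟨ lhs i o u u′ v v′ ⟩
  (i * u + u′) * (i * v + v′) + i * o * u * v + o * (u * v′) ≤⟨ +-monoʳ-≤ _ (*-monoʳ-≤ o uv′≤u′v) ⟩
  (i * u + u′) * (i * v + v′) + i * o * u * v + o * (u′ * v) ≡⟨ rhs i o u u′ v v′ ⟨
  (i * u + u′) * ((i + o) * v + v′)                ∎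
  where
  open ≤-Reasoning
  lhs : ∀ i o u u′ v v′ → ((i + o) * u + u′) * (i * v + v′)
      ≡ (i * u + u′) * (i * v + v′) + i * o * u * v + o * (u * v′)
  lhs = solve-∀
  rhs : ∀ i o u u′ v v′ → (i * u + u′) * ((i + o) * v + v′)
      ≡ (i * u + u′) * (i * v + v′) + i * o * u * v + o * (u′ * v)
  rhs = solve-∀

-- The search runs down from `d`, so `i` is the last index before `d` with `f i ≤ N`.
crossing : ∀ (f : ℕ → ℕ) {N} d → f 0 ≤ N → N < f d → ∃[ i ] i < d × f i ≤ N × N < f (suc i)
crossing f zero f0≤N N<f0 = ⊥-elim (<⇒≱ N<f0 f0≤N)
crossing f {N} (suc d) f0≤N N<fd with f d ≤? N
... | yes fd≤N = d , n<1+n d , fd≤N , N<fd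
... | no  fd≰N = let i , i<d , rest = crossing f d f0≤N (≰⇒> fd≰N) in i , m<n⇒m<1+n i<d , rest

-- Recurrences and the order of convergents.

module _ (a : PartialQuotients) where

  -- Starting at index 2 avoids the values at index -1, so `p a` and `q a` qualify by definition.
  Recurrent : (ℕ → ℕ) → Set
  Recurrent u = ∀ n → u (2 + n) ≡ digit a (2 + n) * u (1 + n) + u n

  -- For fixed `k` both inequalities are linear in the later pair of terms, so the recurrence passes
  -- them on. Two consecutive indices are carried because its order is two; the older inequality
  -- starts as an equality, and strictness comes from the newer one, whose coefficient is a positive
  -- digit.
  ratio-grows : ∀ {u v} → Recurrent u → Recurrent v →
    ∀ k → u k * v (1 + k) < u (1 + k) * v k →
    ∀ i → u k * v (i + k) ≤ u (i + k) * v k × u k * v (1 + i + k) < u (1 + i + k) * v k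
  ratio-grows ru rv k lt zero = ≤-refl , lt
  ratio-grows {u} {v} ru rv k lt (suc i) =
    let le , lt′ = ratio-grows ru rv k lt i
    in <⇒≤ lt′ , (begin-strict
      u k * v (2 + m)                        ≡⟨ cong (u k *_) (rv m) ⟩
      u k * (d * v (1 + m) + v m)            ≡⟨ lhs (u k) d (v (1 + m)) (v m) ⟩
      d * (u k * v (1 + m)) + u k * v m      <⟨ +-mono-<-≤ (*-monoʳ-< d {{nonZero a (1 + m)}} lt′) le ⟩
      d * (u (1 + m) * v k) + u m * v k      ≡⟨ rhs (v k) d (u (1 + m)) (u m) ⟨
      (d * u (1 + m) + u m) * v k            ≡⟨ cong (_* v k) (ru m) ⟨
      u (2 + m) * v k                        ∎)
    where
    open ≤-Reasoning
    m = i + k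
    d = digit a (2 + m)
    lhs : ∀ w d y z → w * (d * y + z) ≡ d * (w * y) + w * z
    lhs = solve-∀
    rhs : ∀ w d y z → (d * y + z) * w ≡ d * (y * w) + z * w
    rhs = solve-∀

  p-recurrent : Recurrent (p a)
  p-recurrent _ = refl

  q-recurrent : Recurrent (q a)
  q-recurrent _ = refl

  p≤q : ∀ n → p a n ≤ q a n
  p≤q n = proj₁ (both n)
    where
    both : ∀ n → p a n ≤ q a n × p a (suc n) ≤ q a (suc n)
    -- At index 1 the claim is `1 ≤ a₁`, as `p₁ = 1` and `q₁ = a₁`.
    both zero    = z≤n , subst (λ e → e + 1 ≤ d * 1 + 0) (sym (*-zeroʳ d))
                     (subst (1 ≤_) (sym (trans (+-identityʳ _) (*-identityʳ d)))
                       (>-nonZero⁻¹ d {{nonZero a 0}}))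
      where d = digit a 1
    both (suc n) = let le , le′ = both n in
      le′ , +-mono-≤ (*-monoʳ-≤ (digit a (2 + n)) le′) le

  -- Above is Below with p and q exchanged, since reciprocals reverse the order; so each
  -- lemma about a pair of sequences u, v serves both orientations.
  Below Above : ℕ → Set
  Below k = p₋₁ a k * q a k ≡ p a k * q₋₁ a k + 1
  Above k = q₋₁ a k * p a k ≡ q a k * p₋₁ a k + 1

  private
    commute : ∀ {u v w z} → u * v ≡ w * z + 1 → v * u ≡ z * w + 1
    commute {u} {v} {w} {z} eq = trans (*-comm v u) (trans eq (cong (_+ 1) (*-comm w z)))

  below⇒above : ∀ k → Below k → Above (suc k)
  below⇒above k b = commute {p a (suc k)} {q a k} {p a k} {q a (suc k)}
    (adjacent-step (digit a (suc k)) (p a k) (p₋₁ a k) (q a k) (q₋₁ a k) b)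

  above⇒below : ∀ k → Above k → Below (suc k)
  above⇒below k b = commute {q a (suc k)} {p a k} {q a k} {p a (suc k)}
    (adjacent-step (digit a (suc k)) (q a k) (q₋₁ a k) (p a k) (p₋₁ a k) b)

  -- The determinant `pₖ₋₁ qₖ - pₖ qₖ₋₁` is `(-1)^k`: even `k` are `Below`, odd `k` are `Above`.
  orientation : ∀ k → Below k ⊎ Above k
  orientation zero    = inj₁ refl
  orientation (suc k) with orientation k
  ... | inj₁ b = inj₂ (below⇒above k b)
  ... | inj₂ b = inj₁ (above⇒below k b)

  ratio-grows-≤ : ∀ {u v} → Recurrent u → Recurrent v →
    ∀ {k m} → u k * v (1 + k) < u (1 + k) * v k → k ≤ m →
    u k * v m ≤ u m * v k × u k * v (suc m) < u (suc m) * v k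
  ratio-grows-≤ {u} {v} ru rv {k} {m} lt k≤m =
    subst (λ j → u k * v j ≤ u j * v k × u k * v (suc j) < u (suc j) * v k)
      (m∸n+n≡m k≤m) (ratio-grows ru rv k lt (m ∸ k))

  below⇒grows : ∀ {k m} → Below k → k ≤ m →
    p a k * q a m ≤ p a m * q a k × p a k * q a (suc m) < p a (suc m) * q a k
  below⇒grows {k} b = ratio-grows-≤ p-recurrent q-recurrent
    (m≡n+1⇒n<m (adjacent-step (digit a (suc k)) (p a k) (p₋₁ a k) (q a k) (q₋₁ a k) b))

  above⇒shrinks : ∀ {k m} → Above k → k ≤ m →
    p a m * q a k ≤ p a k * q a m × p a (suc m) * q a k < p a k * q a (suc m)
  above⇒shrinks {k} {m} b k≤m =
    let le , lt′ = ratio-grows-≤ q-recurrent p-recurrent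
          (m≡n+1⇒n<m (adjacent-step (digit a (suc k)) (q a k) (q₋₁ a k) (p a k) (p₋₁ a k) b)) k≤m
    in subst₂ _≤_ (*-comm (q a k) (p a m)) (*-comm (q a m) (p a k)) le
     , subst₂ _<_ (*-comm (q a k) (p a (suc m))) (*-comm (q a (suc m)) (p a k)) lt′

  -- Positions of convergents, mediants and `x`.

  private
    q≢0 : ∀ k → NonZero (q a k)
    q≢0 k = q-nonZero {a} {k}

    q+q₋₁≢0 : ∀ k → NonZero (q a k + q₋₁ a k)
    q+q₋₁≢0 k = q+q₋₁-nonZero {a} {k}

  below⇒convergent-≤ : ∀ {k m} → Below k → k ≤ m → convergent a k ℚ.≤ convergent a m
  below⇒convergent-≤ {k} {m} b k≤m =
    /-mono-≤ (p a k) (q a k) (p a m) (q a m) {{q≢0 k}} {{q≢0 m}} (proj₁ (below⇒grows b k≤m))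

  below⇒convergent-< : ∀ {k m} → Below k → k ≤ m → convergent a k ℚ.< convergent a (suc m)
  below⇒convergent-< {k} {m} b k≤m =
    /-mono-< (p a k) (q a k) (p a (suc m)) (q a (suc m)) {{q≢0 k}} {{q≢0 (suc m)}}
      (proj₂ (below⇒grows b k≤m))

  above⇒convergent-≥ : ∀ {k m} → Above k → k ≤ m → convergent a m ℚ.≤ convergent a k
  above⇒convergent-≥ {k} {m} b k≤m =
    /-mono-≤ (p a m) (q a m) (p a k) (q a k) {{q≢0 m}} {{q≢0 k}} (proj₁ (above⇒shrinks b k≤m))

  above⇒convergent-> : ∀ {k m} → Above k → k ≤ m → convergent a (suc m) ℚ.< convergent a k
  above⇒convergent-> {k} {m} b k≤m =
    /-mono-< (p a (suc m)) (q a (suc m)) (p a k) (q a k) {{q≢0 (suc m)}} {{q≢0 k}}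
      (proj₂ (above⇒shrinks b k≤m))

  -- The strict inequality at `suc m` is added to the weak one at `m`, which is an equality when
  -- `m = k`. With `below⇒convergent-<` it puts both endpoints of every deeper interval strictly
  -- beyond convergent `k`.
  below⇒mediant-> : ∀ {k m} → Below k → k ≤ m → convergent a k ℚ.< mediant a (suc m)
  below⇒mediant-> {k} {m} b k≤m =
    let le , lt′ = below⇒grows b k≤m in
    /-mono-< (p a k) (q a k) (p a (suc m) + p a m) (q a (suc m) + q a m) {{q≢0 k}} {{q+q₋₁≢0 (suc m)}}
      (subst₂ _<_ (sym (*-distribˡ-+ (p a k) _ _)) (sym (*-distribʳ-+ (q a k) (p a (suc m)) (p a m)))
        (+-mono-<-≤ lt′ le))

  above⇒mediant-< : ∀ {k m} → Above k → k ≤ m → mediant a (suc m) ℚ.< convergent a k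
  above⇒mediant-< {k} {m} b k≤m =
    let le , lt′ = above⇒shrinks b k≤m in
    /-mono-< (p a (suc m) + p a m) (q a (suc m) + q a m) (p a k) (q a k) {{q+q₋₁≢0 (suc m)}} {{q≢0 k}}
      (subst₂ _<_ (sym (*-distribʳ-+ (q a k) (p a (suc m)) (p a m))) (sym (*-distribˡ-+ (p a k) _ _))
        (+-mono-<-≤ lt′ le))

  -- Limits preserve only weak inequalities. Convergent `k + 2`, again below, provides a strict gap
  -- between convergent `k` and all later ones.
  below⇒lower : ∀ x k → x ≃[0⨾ a ] → Below k → lower x (convergent a k)
  below⇒lower x k x≃a b = lower-limit x (2 + k) x≃a
    (below⇒convergent-< b (n≤1+n k))
    (λ m → below⇒convergent-≤ (above⇒below (suc k) (below⇒above k b)))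

  above⇒upper : ∀ x k → x ≃[0⨾ a ] → Above k → upper x (convergent a k)
  above⇒upper x k x≃a b = upper-limit x (2 + k) x≃a
    (above⇒convergent-> b (n≤1+n k))
    (λ m → above⇒convergent-≥ (below⇒above (suc k) (above⇒below k b)))

  -- Semiconvergents.

  semiNum semiDen : ℕ → ℕ → ℕ
  semiNum k i = i * p a k + p₋₁ a k
  semiDen k i = i * q a k + q₋₁ a k

  semiDen-nonZero : ∀ k i → NonZero (semiDen k (suc i))
  semiDen-nonZero k i = >-nonZero (<-≤-trans (>-nonZero⁻¹ (q a k) {{q≢0 k}})
    (≤-trans (m≤m+n (q a k) (i * q a k)) (m≤m+n _ (q₋₁ a k))))

  -- The index is shifted: semiconvergent k i has j = i + 1.
  semiconvergent : ℕ → ℕ → ℚ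
  semiconvergent k i = _/_ (+ semiNum k (suc i)) (semiDen k (suc i)) {{semiDen-nonZero k i}}

  semiconvergent-0 : ∀ k → semiconvergent k 0 ≡ mediant a k
  semiconvergent-0 k = ℚₚ./-cong {{semiDen-nonZero k 0}} {{q+q₋₁≢0 k}}
    (cong (λ e → + (e + p₋₁ a k)) (*-identityˡ (p a k)))
    (cong (_+ q₋₁ a k) (*-identityˡ (q a k)))

  below⇒semiconvergent-bounds : ∀ {k i} → Below k → i < digit a (suc k) →
    convergent a (suc k) ℚ.≤ semiconvergent k i × semiconvergent k i ℚ.≤ mediant a k
  below⇒semiconvergent-bounds {k} {i} b i<d =
      -- At multiplier `digit a (suc k)`, `semiNum k` and `semiDen k` unfold to `p a (suc k)` and
      -- `q a (suc k)`; `i<d` reads `suc i ≤ digit a (suc k)`.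
      /-mono-≤ (p a (suc k)) (q a (suc k)) (semiNum k (suc i)) (semiDen k (suc i))
        {{q≢0 (suc k)}} {{semiDen-nonZero k i}} (antitone i<d)
    , subst (semiconvergent k i ℚ.≤_) (semiconvergent-0 k)
        (/-mono-≤ (semiNum k (suc i)) (semiDen k (suc i)) (semiNum k 1) (semiDen k 1)
          {{semiDen-nonZero k i}} {{semiDen-nonZero k 0}} (antitone {1} {suc i} (s≤s z≤n)))
    where
    antitone : ∀ {i j} → i ≤ j → semiNum k j * semiDen k i ≤ semiNum k i * semiDen k j
    antitone = semiconvergent-antitone (p a k) (p₋₁ a k) (q a k) (q₋₁ a k) (<⇒≤ (m≡n+1⇒n<m b))

  above⇒semiconvergent-bounds : ∀ {k i} → Above k → i < digit a (suc k) →
    semiconvergent k i ℚ.≤ convergent a (suc k) × mediant a k ℚ.≤ semiconvergent k i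
  above⇒semiconvergent-bounds {k} {i} b i<d =
      /-mono-≤ (semiNum k (suc i)) (semiDen k (suc i)) (p a (suc k)) (q a (suc k))
        {{semiDen-nonZero k i}} {{q≢0 (suc k)}} (monotone i<d)
    , subst (ℚ._≤ semiconvergent k i) (semiconvergent-0 k)
        (/-mono-≤ (semiNum k 1) (semiDen k 1) (semiNum k (suc i)) (semiDen k (suc i))
          {{semiDen-nonZero k 0}} {{semiDen-nonZero k i}} (monotone {1} {suc i} (s≤s z≤n)))
    where
    monotone : ∀ {i j} → i ≤ j → semiNum k i * semiDen k j ≤ semiNum k j * semiDen k i
    monotone {i} {j} i≤j =
      subst₂ _≤_ (*-comm (semiDen k j) (semiNum k i)) (*-comm (semiDen k i) (semiNum k j))
        (semiconvergent-antitone (q a k) (q₋₁ a k) (p a k) (p₋₁ a k) (<⇒≤ (m≡n+1⇒n<m b)) i≤j)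

  -- The Farey interval around `x`.

  -- Here `j = i + 1`. The last bound `semiDen k (2 + i)` is also `q a k + semiDen k (suc i)`, the
  -- sum of the two endpoint denominators that `adjacent⇒FareyInterval` compares with `n + 1`.
  LastSemiconvergent : ℕ → ℕ → ℕ → Set
  LastSemiconvergent n k i =
    i < digit a (suc k) × semiDen k (suc i) ≤ n + 1 × n + 1 < semiDen k (2 + i)

  -- The two bounds of `Window` are the values of `semiDen k (suc i)` at `i = 0` and
  -- `i = digit a (suc k)`.
  lastSemiconvergent : ∀ {n k} → Window a n k → ∃[ i ] LastSemiconvergent n k i
  lastSemiconvergent {n} {k} (lo , hi) = crossing (λ i → semiDen k (suc i)) (digit a (suc k))
    (subst (λ e → e + q₋₁ a k ≤ n + 1) (sym (*-identityˡ (q a k))) lo)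
    (subst (n + 1 <_) (regroup (digit a (suc k)) (q a k) (q₋₁ a k)) hi)
    where
    regroup : ∀ d u v → d * u + v + u ≡ suc d * u + v
    regroup = solve-∀

  -- The index is a successor because `p₋₁ = 1` exceeds `q₋₁ = 0` at index 0.
  semiNum≤semiDen : ∀ k i → semiNum (suc k) i ≤ semiDen (suc k) i
  semiNum≤semiDen k i = +-mono-≤ (*-monoʳ-≤ i (p≤q (suc k))) (p≤q k)

  below⇒FareyInterval : ∀ {n k i} → Below (suc k) → Window a n (suc k) →
    LastSemiconvergent n (suc k) i →
    FareyInterval n ⟨ convergent a (suc k) , semiconvergent (suc k) i ⟩
  below⇒FareyInterval {n} {k} {i} b (lo , _) (_ , den≤ , <den) =
    adjacent⇒FareyInterval n (p a K) (q a K) (semiNum K (suc i)) (semiDen K (suc i))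
      {{q≢0 K}} {{semiDen-nonZero K i}}
      (p≤q K) (semiNum≤semiDen k (suc i)) (≤-trans (m≤m+n (q a K) (q a k)) lo) den≤
      (adjacent-step (suc i) (p a K) (p a k) (q a K) (q a k) b)
      (subst (n + 1 <_) (+-assoc (q a K) _ (q a k)) <den)
    where K = suc k

  above⇒FareyInterval : ∀ {n k i} → Above (suc k) → Window a n (suc k) →
    LastSemiconvergent n (suc k) i →
    FareyInterval n ⟨ semiconvergent (suc k) i , convergent a (suc k) ⟩
  above⇒FareyInterval {n} {k} {i} b (lo , _) (_ , den≤ , <den) =
    adjacent⇒FareyInterval n (semiNum K (suc i)) (semiDen K (suc i)) (p a K) (q a K)
      {{semiDen-nonZero K i}} {{q≢0 K}}
      (semiNum≤semiDen k (suc i)) (p≤q K) den≤ (≤-trans (m≤m+n (q a K) (q a k)) lo)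
      (commute {semiDen K (suc i)} {p a K} {q a K} {semiNum K (suc i)}
        (adjacent-step (suc i) (q a K) (q a k) (p a K) (p a k) b))
      (subst (n + 1 <_) (trans (+-assoc (q a K) _ (q a k)) (+-comm (q a K) _)) <den)
    where K = suc k

  -- The Lochs index.

  greatest⇒IsSupremum : ∀ {I k} → I ⊆ cfInterval a k →
    (∀ m → k ≤ m → ¬ (I ⊆ cfInterval a (suc m))) → IsSupremum (λ ℓ → I ⊆ cfInterval a ℓ) k
  greatest⇒IsSupremum {I} {k} I⊆ I⊈ = bound , λ m f → f k I⊆
    where
    bound : ∀ ℓ → I ⊆ cfInterval a ℓ → ℓ ≤ k
    bound zero    _   = z≤n
    bound (suc m) sub with k ≤? m
    ... | yes k≤m = ⊥-elim (I⊈ m k≤m sub)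
    ... | no  k≰m = ≰⇒> k≰m

  lochsIndex : ∀ x {n k} → x ≃[0⨾ a ] → Window a n (suc k) → LochsIndex x a n (suc k)
  lochsIndex x {n} {k} x≃a win with lastSemiconvergent win | orientation (suc k)
  ... | i , last@(i<d , _) | inj₁ b =
    let farey = below⇒FareyInterval b win last
        c≤s , s≤μ = below⇒semiconvergent-bounds b i<d
        c = convergent a (suc k)
        μ = mediant a (suc k)
    in _ , farey
     -- `x` lies between two consecutive convergents, and the semiconvergent is at or beyond the
     -- later one.
     , (below⇒lower x (suc k) x≃a b , upper-≤ x c≤s (above⇒upper x (2 + k) x≃a (below⇒above (suc k) b)))
     , greatest⇒IsSupremum
         (⊆-intro (ℚₚ.p⊓q≤p c μ) (ℚₚ.≤-trans s≤μ (ℚₚ.p≤q⊔p c μ)))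
         -- Depth `suc m` exceeds the index, so both endpoints there, hence their minimum, lie to
         -- the right of `c`.
         (λ m k<m → left<left⇒⊈ (FareyInterval.left<right farey)
           (⊓-pres-< (below⇒convergent-< b k<m) (below⇒mediant-> b k<m)))
  ... | i , last@(i<d , _) | inj₂ b =
    let farey = above⇒FareyInterval b win last
        s≤c , μ≤s = above⇒semiconvergent-bounds b i<d
        c = convergent a (suc k)
        μ = mediant a (suc k)
    in _ , farey
     , (lower-≤ x s≤c (below⇒lower x (2 + k) x≃a (above⇒below (suc k) b)) , above⇒upper x (suc k) x≃a b)
     , greatest⇒IsSupremum
         (⊆-intro (ℚₚ.≤-trans (ℚₚ.p⊓q≤q c μ) μ≤s) (ℚₚ.p≤p⊔q c μ))
         (λ m k<m → right<right⇒⊈ (FareyInterval.left<right farey)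
           (⊔-pres-< (above⇒convergent-> b k<m) (above⇒mediant-< b k<m)))

proposition5p5 : (x : ℝ) → x ∈ unitInterval → Irrational x →
    (a : PartialQuotients) → x ≃[0⨾ a ] →
    (n : ℕ) → 1 ≤ n →
    (k : ℕ) → 1 ≤ k → Window a n k →
    (∀ j → 1 ≤ j → Window a n j → j ≡ k) →
    LochsIndex x a n k
proposition5p5 x _ _ a x≃a n _ (suc k) _ win _ = lochsIndex a x x≃a win
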